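{- Let $\lambda$ be an infinite cardinal and let $\lambda'=2^{<\lambda}$. Then $(\lambda')^{<\mathrm{cof}(\lambda)}=\lambda'$, and the space ${}^{\lambda}2$ is homeomorphic to a closed subspace of ${}^{\mathrm{cof}(\lambda)}\lambda'$ (both with the bounded topology).
   Context: For a set $A$ and an ordinal $\gamma$, ${}^{\gamma}A$ is the set of sequences of elements of $A$ of length $\gamma$, with the bounded topology, generated by the cones $\mathbf{N}_s=\{x\in{}^{\gamma}A\mid s\subseteq x\}$ for $s\in{}^{<\gamma}A=\bigcup_{\alpha<\gamma}{}^{\alpha}A$. $\mathrm{cof}(\lambda)$ is the cofinality of $\lambda$, and $\nu^{<\theta}=\sup\{\nu^{\rho}\mid\rho<\theta\text{ a cardinal}\}$ (cardinal exponentiation). -}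

-- Set-theoretic cardinals, cofinality and the bounded topology, inside type
-- theory.  Ordinals are well-ordered types; a sequence of length γ is a
-- function on the carrier of γ.  Cofinality and the weak power are given as
-- relations ("κ is the cofinality of γ"), since without choice principles
-- there is no function returning the ordinal in question.
--
-- These definitions have their set-theoretic meaning in the presence of
-- excluded middle and function extensionality.  Because ExcludedMiddle decides
-- arbitrary types, P ↦ excludedMiddle {Σ A (λ x → P x ≡ true)} is then a choice
-- function on the inhabited subsets P : A → Bool of any A, so that the axiom of
-- choice (and with it the well-ordering theorem) is available as well.

module Defs where

open import Data.Fin.Base using (Fin)
open import Data.Product.Base using (Σ-syntax; ∃-syntax; _×_; _,_; proj₁; proj₂)
open import Data.Refinement.Base using (Refinement; Refinement-syntax; value; _,_)
open import Data.Sum.Base using (_⊎_)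
open import Data.Unit.Polymorphic.Base using (⊤)
open import Function.Base using (_∘_; _on_)
open import Function.Bundles using (_↔_; _↣_; Inverse)
open import Induction.WellFounded using (WellFounded)
open import Level using (Level; _⊔_; suc)
open import Relation.Binary.Construct.On as On using ()
open import Relation.Binary.Core using (Rel)
open import Relation.Binary.Definitions using (Trichotomous; tri<; tri≈; tri>)
open import Relation.Binary.PropositionalEquality.Core using (_≡_; refl; cong)
open import Relation.Binary.PropositionalEquality.Properties using (isEquivalence)
open import Relation.Binary.Structures using (IsStrictTotalOrder)
open import Relation.Nullary.Negation.Core using (¬_)
open import Relation.Unary using (Pred; _≐_; _∩_; ⋃; ∁)

private
  variable
    a ℓ : Level

record Ordinal (ℓ : Level) : Set (suc ℓ) where
  infix 4 _<_
  field
    Carrier            : Set ℓ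
    _<_                : Rel Carrier ℓ
    isStrictTotalOrder : IsStrictTotalOrder _≡_ _<_
    wellFounded        : WellFounded _<_

  open IsStrictTotalOrder isStrictTotalOrder public using (compare; trans; irrefl)

  infix 4 _≤_
  _≤_ : Rel Carrier ℓ
  x ≤ y = x < y ⊎ x ≡ y

⟨_⟩ : Ordinal ℓ → Set ℓ
⟨_⟩ = Ordinal.Carrier

-- The ordinals smaller than γ are, up to isomorphism, the initial segments
-- γ ↓ α for α in γ.  Membership is proof-irrelevant, so that γ ↓ α has exactly
-- one point for each ξ < α.
infixl 8 _↓_

_↓_ : (γ : Ordinal ℓ) → ⟨ γ ⟩ → Ordinal ℓ
_↓_ {ℓ} γ α = record
  { Carrier            = Segment
  ; _<_                = _<_ on value
  ; isStrictTotalOrder = record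
    { isStrictPartialOrder = record
      { isEquivalence = isEquivalence
      ; irrefl        = λ p → irrefl (cong value p)
      ; trans         = trans
      ; <-resp-≈      = (λ { refl p → p }) , (λ { refl p → p })
      }
    ; compare = cmp
    }
  ; wellFounded = On.wellFounded value wellFounded
  }
  where
  open Ordinal γ

  Segment : Set ℓ
  Segment = [ ξ ∈ Carrier ∣ ξ < α ]

  cmp : Trichotomous {A = Segment} _≡_ (_<_ on value)
  cmp (x , p) (y , q) with compare x y
  ... | tri< l n g    = tri< l (n ∘ cong value) g
  ... | tri≈ l refl g = tri≈ l refl g
  ... | tri> l n g    = tri> l (n ∘ cong value) g

IsCardinal : Ordinal ℓ → Set ℓ
IsCardinal γ = ∀ α → ¬ (⟨ γ ⟩ ↔ ⟨ γ ↓ α ⟩)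

Infinite : Set a → Set a
Infinite A = ¬ (∃[ n ] (A ↔ Fin n))

-- κ = cof(γ), the least ordinal with a map into γ whose range is cofinal.
IsCofinality : Ordinal ℓ → Ordinal ℓ → Set ℓ
IsCofinality γ κ =
  HasCofinalMap κ × (∀ ι → ¬ HasCofinalMap (κ ↓ ι))
  where
  open Ordinal γ using (_≤_)

  HasCofinalMap : Ordinal _ → Set _
  HasCofinalMap δ = Σ[ f ∈ (⟨ δ ⟩ → ⟨ γ ⟩) ] (∀ ξ → ∃[ ι ] (ξ ≤ f ι))

-- τ = |ν|^{<θ}: the cardinal τ is the supremum of the cardinals |ν|^ρ, over
-- the cardinals ρ < θ.  Inequalities of cardinals are injections.
record IsWeakPower (ν : Set a) (θ : Ordinal ℓ) (τ : Ordinal (a ⊔ ℓ)) : Set (suc (a ⊔ ℓ)) where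

  UpperBound : Ordinal (a ⊔ ℓ) → Set (a ⊔ ℓ)
  UpperBound σ = ∀ ρ → IsCardinal (θ ↓ ρ) → (⟨ θ ↓ ρ ⟩ → ν) ↣ ⟨ σ ⟩

  field
    isCardinal : IsCardinal τ
    upperBound : UpperBound τ
    least      : ∀ σ → IsCardinal σ → UpperBound σ → ⟨ τ ⟩ ↣ ⟨ σ ⟩

record Topology (X : Set ℓ) : Set (suc (suc ℓ)) where
  field
    Open      : Pred X ℓ → Set (suc ℓ)
    Open-resp : ∀ {P Q} → P ≐ Q → Open P → Open Q
    Open-⊤    : Open (λ _ → ⊤)
    Open-∩    : ∀ {P Q} → Open P → Open Q → Open (P ∩ Q)
    Open-⋃    : ∀ {I : Set ℓ} {P : I → Pred X ℓ} → (∀ j → Open (P j)) → Open (⋃ I P)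

  Closed : Pred X ℓ → Set (suc ℓ)
  Closed P = Open (∁ P)

open Topology

data GeneratedOpen {X I : Set ℓ} (B : I → Pred X ℓ) : Pred X ℓ → Set (suc ℓ) where
  basic : ∀ j → GeneratedOpen B (B j)
  resp  : ∀ {P Q} → P ≐ Q → GeneratedOpen B P → GeneratedOpen B Q
  whole : GeneratedOpen B (λ _ → ⊤)
  inter : ∀ {P Q} → GeneratedOpen B P → GeneratedOpen B Q → GeneratedOpen B (P ∩ Q)
  union : ∀ {J : Set ℓ} {P : J → Pred X ℓ} →
          (∀ j → GeneratedOpen B (P j)) → GeneratedOpen B (⋃ J P)

generated : {X I : Set ℓ} → (I → Pred X ℓ) → Topology X
generated B = record
  { Open      = GeneratedOpen B
  ; Open-resp = resp
  ; Open-⊤    = whole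
  ; Open-∩    = inter
  ; Open-⋃    = union
  }

subspace : {X : Set ℓ} → Topology X → (C : Pred X ℓ) → Topology (Refinement X C)
subspace {X = X} 𝒯 C = record
  { Open      = λ P → Σ[ V ∈ Pred X _ ] (Open 𝒯 V × P ≐ (V ∘ value))
  ; Open-resp = λ { (P⊆Q , Q⊆P) (V , oV , P⊆V , V⊆P) →
                    V , oV , (λ q → P⊆V (Q⊆P q)) , (λ v → P⊆Q (V⊆P v)) }
  ; Open-⊤    = (λ _ → ⊤) , Open-⊤ 𝒯 , (λ t → t) , (λ t → t)
  ; Open-∩    = λ { (V , oV , P⊆V , V⊆P) (W , oW , Q⊆W , W⊆Q) →
                    V ∩ W , Open-∩ 𝒯 oV oW
                    , (λ { (p , q) → P⊆V p , Q⊆W q })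
                    , (λ { (v , w) → V⊆P v , W⊆Q w }) }
  ; Open-⋃    = λ {I} o →
                    ⋃ I (λ j → proj₁ (o j)) , Open-⋃ 𝒯 (λ j → proj₁ (proj₂ (o j)))
                    , (λ { (j , p) → j , proj₁ (proj₂ (proj₂ (o j))) p })
                    , (λ { (j , v) → j , proj₂ (proj₂ (proj₂ (o j))) v })
  }

Continuous : {X Y : Set ℓ} → Topology X → Topology Y → (X → Y) → Set (suc ℓ)
Continuous 𝒮 𝒯 f = ∀ V → Open 𝒯 V → Open 𝒮 (V ∘ f)

Homeomorphic : {X Y : Set ℓ} → Topology X → Topology Y → Set (suc ℓ)
Homeomorphic {X = X} {Y = Y} 𝒮 𝒯 =
  Σ[ e ∈ (X ↔ Y) ] (Continuous 𝒮 𝒯 (Inverse.to e) × Continuous 𝒯 𝒮 (Inverse.from e))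

HomeomorphicToClosedSubspace : {X Y : Set ℓ} → Topology X → Topology Y → Set (suc ℓ)
HomeomorphicToClosedSubspace {ℓ} {Y = Y} 𝒮 𝒯 =
  Σ[ C ∈ Pred Y ℓ ] (Closed 𝒯 C × Homeomorphic 𝒮 (subspace 𝒯 C))

module _ (γ : Ordinal ℓ) (A : Set a) where

  Sequence : Set (a ⊔ ℓ)
  Sequence = ⟨ γ ⟩ → A

  -- The set written ^{<γ}A.
  BoundedSequence : Set (a ⊔ ℓ)
  BoundedSequence = Σ[ α ∈ ⟨ γ ⟩ ] (⟨ γ ↓ α ⟩ → A)

  cone : BoundedSequence → Pred Sequence (a ⊔ ℓ)
  cone (α , s) x = ∀ ξ → x (value ξ) ≡ s ξ

  bounded : Topology Sequence
  bounded = generated cone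

-- Write T for the set of binary sequences of length < λ.  Comparability of
-- cardinals and Hessenberg's theorem κ × κ ≤ κ give |T| = 2^{<λ} = λ′.  For
-- ρ < cof(λ), the members of a family ρ → T have lengths below a common ξ < λ,
-- so the family is determined by ξ and a subset of a set of size < λ; there are
-- thus at most λ · λ′ = λ′ families.  For the embedding, take f : cof(λ) → λ
-- cofinal and send x to the sequence of (codes of) its restrictions x ↾ f(ι).
-- Restrictions of x to a bounded part of λ and of its image to a bounded part of
-- cof(λ) determine each other, because f is bounded on proper initial segments.
module Submission where

open import Defs
open import Axiom.ExcludedMiddle using (ExcludedMiddle)
open import Axiom.Extensionality.Propositional using (Extensionality)
open import Data.Bool.Base using (Bool; true; false)
open import Data.Fin.Base using (Fin; zero; suc; toℕ; fromℕ<; punchOut; combine)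
open import Data.Fin.Properties
  using (fromℕ<-injective; punchOut-injective; combine-injective; pigeonhole; suc-injective; 2↔Bool)
open import Data.Irrelevant using ([_])
open import Data.Maybe.Base as Maybe using (Maybe; just; nothing)
open import Data.Maybe.Properties using (just-injective; map-injective)
open import Data.Nat.Base as ℕ using (ℕ; zero; suc)
import Data.Nat.Induction as ℕ
import Data.Nat.Properties as ℕ
open import Data.Product.Base using (Σ-syntax; ∃-syntax; _×_; _,_; proj₁; proj₂)
open import Data.Product.Properties using (,-injectiveˡ; ,-injectiveʳ)
open import Data.Product.Relation.Binary.Lex.Strict using (×-Lex; ×-wellFounded)
open import Data.Refinement.Base using (Refinement; value; _,_)
open import Data.Refinement.Properties using (value-injective)
open import Data.Sum.Base using (_⊎_; inj₁; inj₂; [_,_]′)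
open import Function.Base using (_∘_; _on_; id)
open import Function.Bundles using (_↔_; _↣_; mk↣; mk↔ₛ′; module Injection; module Inverse)
open import Function.Properties.Injection using (↣-trans; ↣-refl)
open import Function.Properties.Inverse using (↔⇒↣; ↔-refl; ↔-trans; ↔-sym)
open import Induction.WellFounded using (WellFounded; WfRec; module All; module FixPoint)
open import Level using (Level; _⊔_)
open import Relation.Binary.Construct.On as On using ()
open import Relation.Binary.Core using (Rel)
open import Relation.Binary.Definitions using (Trichotomous; Tri; tri<; tri≈; tri>)
open import Relation.Binary.PropositionalEquality.Core using (_≡_; _≢_; refl; sym; trans; cong; cong₂; subst)
open import Relation.Binary.PropositionalEquality.Properties using (isEquivalence)
open import Relation.Nullary.Decidable using (Dec; yes; no; does; recompute; dec-true; dec-false)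
open import Relation.Nullary.Negation.Core using (¬_; contradiction; contradiction-irr)
open import Relation.Unary using (Pred; _⊆_)

private
  variable
    a b c d ℓ : Level
    A : Set a
    B : Set b
    C : Set c
    D : Set d

-- Injections and finite types.

open Injection using (to; injective)

infixr 9 _⨾_

_⨾_ : A ↣ B → B ↣ C → A ↣ C
_⨾_ = ↣-trans

-- The premise `ℕ ↣ A` makes this vacuous for finite types, so that an induction over all segments
-- needs no base case.
SquareBounded : Set a → Set a
SquareBounded A = ℕ ↣ A → (A × A) ↣ A

×-↣ : A ↣ C → B ↣ D → (A × B) ↣ (C × D)
×-↣ f g = mk↣ {to = λ (x , y) → to f x , to g y} λ p →
  cong₂ _,_ (injective f (,-injectiveˡ p)) (injective g (,-injectiveʳ p))

diagonal-↣ : A ↣ (A × A)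
diagonal-↣ = mk↣ {to = λ x → x , x} ,-injectiveˡ

Maybe-↣ : A ↣ B → Maybe A ↣ Maybe B
Maybe-↣ f = mk↣ {to = Maybe.map (to f)} (map-injective (injective f))

ℕ⋠Fin : ∀ n → ¬ (ℕ ↣ Fin n)
ℕ⋠Fin n f with pigeonhole (ℕ.n<1+n n) (to f ∘ toℕ)
... | i , j , i<j , p = ℕ.<-irrefl (injective f p) i<j

Fin×Fin-↣ : ∀ m n → (Fin m × Fin n) ↣ Fin (m ℕ.* n)
Fin×Fin-↣ m n = mk↣ {to = λ (i , j) → combine i j} λ {(i , j)} {(k , l)} p →
  let q , r = combine-injective i j k l p in cong₂ _,_ q r

Maybe-Fin-↣ : ∀ n → Maybe (Fin n) ↣ Fin (suc n)
Maybe-Fin-↣ n = mk↣ {to = f} inj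
  where
  f : Maybe (Fin n) → Fin (suc n)
  f (just i) = suc i
  f nothing  = zero
  inj : ∀ {i j} → f i ≡ f j → i ≡ j
  inj {just i} {just j} p = cong just (suc-injective p)
  inj {nothing} {nothing} p = refl

-- The points of `A` fill the diagonal, which leaves any pair of distinct points free for `nothing`.
Maybe-↣-square : ℕ ↣ A → Maybe A ↣ (A × A)
Maybe-↣-square {A = A} e = mk↣ {to = f} inj
  where
  f : Maybe A → A × A
  f (just x) = x , x
  f nothing  = to e 0 , to e 1
  0≢1 : to e 0 ≢ to e 1
  0≢1 p with injective e p
  ... | ()
  inj : ∀ {x y} → f x ≡ f y → x ≡ y
  inj {just x}  {just y}  p = cong just (,-injectiveˡ p)
  inj {just x}  {nothing} p = contradiction (trans (sym (,-injectiveˡ p)) (,-injectiveʳ p)) 0≢1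
  inj {nothing} {just y}  p = contradiction (trans (,-injectiveˡ p) (sym (,-injectiveʳ p))) 0≢1
  inj {nothing} {nothing} p = refl

-- The orbits under g ∘ f of the points outside the range of g.
data Chain {A : Set a} {B : Set b} (f : A ↣ B) (g : B ↣ A) : A → Set (a ⊔ b) where
  start : ∀ {x} → (∀ y → to g y ≢ x) → Chain f g x
  step  : ∀ {x} → Chain f g x → Chain f g (to g (to f x))

connected : {_<_ : Rel A b} → Trichotomous _≡_ _<_ → ∀ {x y} → x ≢ y → x < y ⊎ y < x
connected cmp {x} {y} x≢y with cmp x y
... | tri< l _ _ = inj₁ l
... | tri≈ _ p _ = contradiction p x≢y
... | tri> _ _ l = inj₂ l

module _ (em : ∀ {a} → ExcludedMiddle a) (ext : ∀ {a b} → Extensionality a b) where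

  -- Classical logic, Cantor and Schröder-Bernstein.

  dec : (P : Set a) → Dec P
  dec P = em

  ¬∀⇒∃ : {P : A → Set b} → ¬ (∀ x → P x) → ∃[ x ] ¬ P x
  ¬∀⇒∃ {P = P} n with dec (∃[ x ] ¬ P x)
  ... | yes e = e
  ... | no ¬e = contradiction (λ x → [ id , (λ np → contradiction (x , np) ¬e) ]′ (split x)) n
    where
    split : ∀ x → P x ⊎ ¬ P x
    split x with dec (P x)
    ... | yes p = inj₁ p
    ... | no np = inj₂ np

  -- Russell's paradox: `R` collects the codes of sets that omit their own code, and `to e R` can be
  -- neither inside nor outside it.
  cantor : ¬ ((A → Bool) ↣ A)
  cantor {A = A} e with dec (Russell (to e R))
    where
    Russell : A → Set _
    Russell x = Σ[ s ∈ (A → Bool) ] (to e s ≡ x × s x ≡ false)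
    R : A → Bool
    R x = does (dec (Russell x))
  ... | yes (s , p , q) = true≢false (
    trans (sym (dec-true (dec _) (s , p , q))) (trans (cong (λ s → s _) (sym (injective e p))) q))
    where
    true≢false : true ≢ false
    true≢false ()
  ... | no n = n (_ , refl , dec-false (dec _) n)

  domain-↣ : C → A ↣ B → (A → C) ↣ (B → C)
  domain-↣ {C = C} {A = A} {B = B} c₀ e = mk↣ {to = extend} λ {s} {t} p →
    ext λ x → trans (sym (extend-to s x)) (trans (cong (λ u → u (to e x)) p) (extend-to t x))
    where
    extend : (A → C) → B → C
    extend s y with dec (∃[ x ] to e x ≡ y)
    ... | yes (x , _) = s x
    ... | no _        = c₀
    extend-to : ∀ s x → extend s (to e x) ≡ s x
    extend-to s x with dec (∃[ x′ ] to e x′ ≡ to e x)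
    ... | yes (x′ , p) = cong s (injective e p)
    ... | no n         = contradiction (x , refl) n

  codomain-↣ : B ↣ C → (A → B) ↣ (A → C)
  codomain-↣ e = mk↣ {to = to e ∘_} λ p → ext λ x → injective e (cong (λ s → s x) p)

  uncurry-↣ : (A → B → C) ↣ (A × B → C)
  uncurry-↣ = mk↣ {to = λ s (x , y) → s x y} λ p → ext λ x → ext λ y → cong (λ s → s (x , y)) p

  -- Points on a `Chain` go forward along `f`, all others back along `g`. `Match` is the graph of
  -- the bijection, total and single-valued in both directions.
  schröder-bernstein : A ↣ B → B ↣ A → A ↔ B
  schröder-bernstein {A = A} {B = B} f g =
    mk↔ₛ′ (proj₁ ∘ total) (proj₁ ∘ surjective)
      (λ y → functional _ (proj₂ (total _)) (proj₂ (surjective y)))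
      (λ x → cofunctional _ (proj₂ (surjective _)) (proj₂ (total x)))
    where
    previous : ∀ {x y} → Chain f g x → x ≡ to g y → ∃[ z ] (Chain f g z × to f z ≡ y)
    previous (start n) p = contradiction (sym p) (n _)
    previous (step c)  p = _ , c , injective g p

    Match : A → B → Set _
    Match x y = (Chain f g x × to f x ≡ y) ⊎ (¬ Chain f g x × to g y ≡ x)

    total : ∀ x → ∃[ y ] Match x y
    total x with dec (Chain f g x)
    ... | yes c = _ , inj₁ (c , refl)
    ... | no ¬c with dec (∃[ y ] to g y ≡ x)
    ...   | yes (y , p) = y , inj₂ (¬c , p)
    ...   | no n        = contradiction (start λ y p → n (y , p)) ¬c

    surjective : ∀ y → ∃[ x ] Match x y
    surjective y with dec (Chain f g (to g y))
    ... | no ¬c = _ , inj₂ (¬c , refl)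
    ... | yes c = let x , c′ , p = previous c refl in x , inj₁ (c′ , p)

    functional : ∀ x {y z} → Match x y → Match x z → y ≡ z
    functional x (inj₁ (_ , p)) (inj₁ (_ , q)) = trans (sym p) q
    functional x (inj₁ (c , _)) (inj₂ (n , _)) = contradiction c n
    functional x (inj₂ (n , _)) (inj₁ (c , _)) = contradiction c n
    functional x (inj₂ (_ , p)) (inj₂ (_ , q)) = injective g (trans p (sym q))

    clash : ∀ {x z y} → Chain f g x → to f x ≡ y → ¬ Chain f g z → to g y ≢ z
    clash c refl n refl = n (step c)

    cofunctional : ∀ y {x z} → Match x y → Match z y → x ≡ z
    cofunctional y (inj₁ (_ , p)) (inj₁ (_ , q)) = injective f (trans p (sym q))
    cofunctional y (inj₁ (c , p)) (inj₂ (n , q)) = contradiction q (clash c p n)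
    cofunctional y (inj₂ (n , q)) (inj₁ (c , p)) = contradiction q (clash c p n)
    cofunctional y (inj₂ (_ , p)) (inj₂ (_ , q)) = trans (sym p) q

  least : {_<_ : Rel A b} → WellFounded _<_ → (P : A → Set c) → ∃[ x ] P x →
          ∃[ x ] (P x × (∀ y → y < x → ¬ P y))
  least {_<_ = _<_} wf P (x , px) = All.wfRec wf _ Q go x px
    where
    Q : _ → Set _
    Q x = P x → ∃[ x ] (P x × (∀ y → y < x → ¬ P y))
    go : ∀ x → WfRec _<_ Q x → Q x
    go x IH px with dec (∃[ y ] (y < x × P y))
    ... | yes (y , y<x , py) = IH y<x py
    ... | no n               = x , px , λ y y<x py → n (y , y<x , py)

  -- Comparability

  module _ {X : Set a} {_<_ : Rel X b} (wf : WellFounded _<_)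
           (compare : ∀ {x y} → x ≢ y → x < y ⊎ y < x) (Y : Set c) where

    Fresh : (x : X) → WfRec _<_ (λ _ → Maybe Y) x → Set _
    Fresh x IH = Σ[ y ∈ Y ] (∀ {z} (l : z < x) → IH l ≢ just y)

    pick : {P : Y → Set d} → Dec (∃[ y ] P y) → Maybe Y
    pick (yes (y , _)) = just y
    pick (no _)        = nothing

    enum-step : (x : X) → WfRec _<_ (λ _ → Maybe Y) x → Maybe Y
    enum-step x IH = pick (dec (Fresh x IH))

    -- Each `x` receives a member of `Y` not given to any predecessor; `nothing` records that the
    -- predecessors have used up `Y`.
    enum : X → Maybe Y
    enum = All.wfRec wf _ _ enum-step

    enum-unfold : ∀ x → enum x ≡ enum-step x (λ {z} _ → enum z)
    enum-unfold x = FixPoint.unfold-wfRec wf _ enum-step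
      (λ x {IH} {IH′} h → cong (λ (r : ∀ z → z < x → Maybe Y) → enum-step x (λ {z} → r z))
        (ext λ z → ext λ l → h l))

    enum-fresh : ∀ {x y z} → enum x ≡ just y → z < x → enum z ≢ just y
    enum-fresh {x} p z<x q with dec (Fresh x (λ {z} _ → enum z)) | trans (sym (enum-unfold x)) p
    ... | yes (_ , f) | refl = f z<x q

    enum-exhausted : ∀ {x} → enum x ≡ nothing → ∀ y → ∃[ z ] (z < x × enum z ≡ just y)
    enum-exhausted {x} p y with dec (Fresh x (λ {z} _ → enum z)) | trans (sym (enum-unfold x)) p
    ... | no n | _ with dec (∃[ z ] (z < x × enum z ≡ just y))
    ...   | yes e = e
    ...   | no ¬e = contradiction (y , λ l q → ¬e (_ , l , q)) n

    -- If `enum` runs out at `x`, every `y` has a place below `x`, and a place holds only one value.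
    -- Otherwise freshness keeps all values distinct.
    comparability : (X ↣ Y) ⊎ ∃[ x ] (Y ↣ Refinement X (_< x))
    comparability with dec (∃[ x ] enum x ≡ nothing)
    ... | yes (x , p) = inj₂ (x , mk↣ {to = λ y → let z , l , _ = enum-exhausted p y in z , [ l ]}
                          λ {y} {y′} q → just-injective (trans (sym (proj₂ (proj₂ (enum-exhausted p y))))
                            (trans (cong (enum ∘ value) q) (proj₂ (proj₂ (enum-exhausted p y′))))))
    ... | no n = inj₁ (mk↣ {to = proj₁ ∘ value-of} inj)
      where
      value-of : ∀ x → ∃[ y ] enum x ≡ just y
      value-of x with enum x in p
      ... | just y  = y , refl
      ... | nothing = contradiction (x , p) n
      inj : ∀ {x y} → proj₁ (value-of x) ≡ proj₁ (value-of y) → x ≡ y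
      inj {x} {y} p with dec (x ≡ y)
      ... | yes q = q
      ... | no q with compare q
      ...   | inj₁ l =
        contradiction (trans (proj₂ (value-of x)) (cong just p)) (enum-fresh (proj₂ (value-of y)) l)
      ...   | inj₂ l =
        contradiction (trans (proj₂ (value-of y)) (cong just (sym p))) (enum-fresh (proj₂ (value-of x)) l)

  infinite-or-finite : (A : Set a) → ℕ ↣ A ⊎ ∃[ n ] (A ↣ Fin n)
  infinite-or-finite A with comparability ℕ.<-wellFounded (connected ℕ.<-cmp) A
  ... | inj₁ e = inj₁ e
  ... | inj₂ (n , e) = inj₂ (n , e ⨾ mk↣ {to = λ { (m , [ m<n ]) → fromℕ< m<n }}
                         λ { {m , [ p ]} {k , [ q ]} r → value-injective (fromℕ<-injective m k p q r) })

  -- As long as some value is missed, punching it out lowers `n`; the descent stops at a surjective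
  -- injection.
  Fin-subset : ∀ n → A ↣ Fin n → ∃[ k ] (A ↔ Fin k)
  Fin-subset {A = A} n e with dec (∀ i → ∃[ x ] to e x ≡ i)
  ... | yes s = n , mk↔ₛ′ (to e) (proj₁ ∘ s) (proj₂ ∘ s) (λ x → injective e (proj₂ (s _)))
  Fin-subset zero e | no n = contradiction (λ ()) n
  Fin-subset (suc n) e | no ¬s with ¬∀⇒∃ ¬s
  ... | i , ¬∃ = Fin-subset n (mk↣ {to = λ x → punchOut (λ p → ¬∃ (x , sym p))}
                   λ p → injective e (punchOut-injective {i = i} _ _ p))

  Infinite⇒ℕ↣ : Infinite A → ℕ ↣ A
  Infinite⇒ℕ↣ {A = A} inf with infinite-or-finite A
  ... | inj₁ e       = e
  ... | inj₂ (n , e) = contradiction (Fin-subset n e) inf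

  -- Ordinals and cardinals

  ordinal-comparability : (γ : Ordinal ℓ) (Y : Set c) → (⟨ γ ⟩ ↣ Y) ⊎ ∃[ α ] (Y ↣ ⟨ γ ↓ α ⟩)
  ordinal-comparability γ = comparability wellFounded (connected compare)
    where open Ordinal γ

  -- Membership in a segment is irrelevant; excluded middle recovers a usable proof.
  ↓-< : (γ : Ordinal ℓ) {α : ⟨ γ ⟩} (β : ⟨ γ ↓ α ⟩) → Ordinal._<_ γ (value β) α
  ↓-< γ (β , [ β<α ]) = recompute em β<α

  ↓-↣ : (γ : Ordinal ℓ) (α : ⟨ γ ⟩) → ⟨ γ ↓ α ⟩ ↣ ⟨ γ ⟩
  ↓-↣ γ α = mk↣ {to = value} value-injective

  ↓-↓ : (γ : Ordinal ℓ) {α : ⟨ γ ⟩} (β : ⟨ γ ↓ α ⟩) → ⟨ γ ↓ α ↓ β ⟩ ↔ ⟨ γ ↓ value β ⟩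
  ↓-↓ γ (β , [ β<α ]) = mk↔ₛ′
    (λ { ((ξ , _) , [ ξ<β ]) → ξ , [ ξ<β ] })
    (λ { (ξ , [ ξ<β ]) → (ξ , [ Ordinal.trans γ ξ<β β<α ]) , [ ξ<β ] })
    (λ _ → refl) (λ _ → refl)

  cardinal-⋠-segment : (γ : Ordinal ℓ) → IsCardinal γ → ∀ α → ¬ (⟨ γ ⟩ ↣ ⟨ γ ↓ α ⟩)
  cardinal-⋠-segment γ card α e = card α (schröder-bernstein e (↓-↣ γ α))

  -- A segment that is not a cardinal is equinumerous with a shorter one, and the descent is
  -- well-founded.
  cardinal-segment : (γ : Ordinal ℓ) (α : ⟨ γ ⟩) → ∃[ ρ ] (IsCardinal (γ ↓ ρ) × ⟨ γ ↓ α ⟩ ↔ ⟨ γ ↓ ρ ⟩)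
  cardinal-segment {ℓ} γ = All.wfRec wellFounded ℓ _ go
    where
    open Ordinal γ
    go : ∀ α → WfRec _<_ (λ α → ∃[ ρ ] (IsCardinal (γ ↓ ρ) × ⟨ γ ↓ α ⟩ ↔ ⟨ γ ↓ ρ ⟩)) α →
         ∃[ ρ ] (IsCardinal (γ ↓ ρ) × ⟨ γ ↓ α ⟩ ↔ ⟨ γ ↓ ρ ⟩)
    go α IH with dec (∃[ β ] (⟨ γ ↓ α ⟩ ↔ ⟨ γ ↓ α ↓ β ⟩))
    ... | no n = α , (λ β e → n (β , e)) , ↔-refl
    ... | yes (β , e) =
      let ρ , card , e′ = IH (↓-< γ β)
      in ρ , card , ↔-trans e (↔-trans (↓-↓ γ β) e′)

  cardinality : (γ : Ordinal ℓ) → ∃[ σ ] (IsCardinal {ℓ} σ × ⟨ γ ⟩ ↔ ⟨ σ ⟩)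
  cardinality γ with dec (∃[ α ] (⟨ γ ⟩ ↔ ⟨ γ ↓ α ⟩))
  ... | no n        = γ , (λ α e → n (α , e)) , ↔-refl
  ... | yes (α , e) = let ρ , card , e′ = cardinal-segment γ α in γ ↓ ρ , card , ↔-trans e e′

  -- Hessenberg's theorem.

  infixl 8 _⇓_
  _⇓_ : (γ : Ordinal ℓ) → ⟨ γ ⟩ → Set ℓ
  γ ⇓ m = Refinement ⟨ γ ⟩ (λ ξ → Ordinal._≤_ γ ξ m)

  ⇓-↣-Maybe : (γ : Ordinal ℓ) (m : ⟨ γ ⟩) → γ ⇓ m ↣ Maybe ⟨ γ ↓ m ⟩
  ⇓-↣-Maybe γ m = mk↣ {to = f} inj
    where
    open Ordinal γ using (_<_; compare; irrefl) renaming (trans to <-trans)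
    f : γ ⇓ m → Maybe ⟨ γ ↓ m ⟩
    f (x , _) with compare x m
    ... | tri< l _ _ = just (x , [ l ])
    ... | tri≈ _ _ _ = nothing
    -- A junk value: membership rules this case out, as `inj` checks with `≯`.
    ... | tri> _ _ _ = nothing
    ≯ : ∀ {x} → m < x → ¬ (Ordinal._≤_ γ x m)
    ≯ m<x (inj₁ x<m)  = irrefl refl (<-trans m<x x<m)
    ≯ m<x (inj₂ refl) = irrefl refl m<x
    inj : ∀ {x y} → f x ≡ f y → x ≡ y
    inj {x , [ p ]} {y , [ q ]} e with compare x m | compare y m
    ... | tri> _ _ g | _ = contradiction-irr p (≯ g)
    ... | _ | tri> _ _ g = contradiction-irr q (≯ g)
    ... | tri≈ _ r _ | tri≈ _ s _ = value-injective (trans r (sym s))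
    ... | tri< _ _ _ | tri< _ _ _ = value-injective (cong value (just-injective e))

  module _ (γ : Ordinal ℓ) (card : IsCardinal γ) (ω≤γ : ℕ ↣ ⟨ γ ⟩)
           (square : ∀ α → SquareBounded ⟨ γ ↓ α ⟩) where

    -- The closed segment has one point more than `γ ↓ m`. If `γ ↓ m` is infinite, it absorbs that
    -- point and the squaring; if it is finite, so is the square, whereas `γ` contains ℕ.
    cardinal-⋠-square : ∀ m → ¬ (⟨ γ ⟩ ↣ (γ ⇓ m × γ ⇓ m))
    cardinal-⋠-square m e with infinite-or-finite ⟨ γ ↓ m ⟩
    ... | inj₁ ω≤m = cardinal-⋠-segment γ card m (e ⨾ ×-↣ f f ⨾ square m ω≤m)
      where
      f : γ ⇓ m ↣ ⟨ γ ↓ m ⟩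
      f = ⇓-↣-Maybe γ m ⨾ Maybe-↣-square ω≤m ⨾ square m ω≤m
    ... | inj₂ (n , i) = ℕ⋠Fin _ (ω≤γ ⨾ e ⨾ ×-↣ f f ⨾ Fin×Fin-↣ (suc n) (suc n))
      where
      f : γ ⇓ m ↣ Fin (suc n)
      f = ⇓-↣-Maybe γ m ⨾ Maybe-↣ i ⨾ Maybe-Fin-↣ n

  module _ (γ : Ordinal ℓ) where

    open Ordinal γ using (_<_; _≤_; compare; wellFounded) renaming (trans to <-trans)

    upper-bound : ∀ x y → ∃[ m ] (x ≤ m × y ≤ m)
    upper-bound x y with compare x y
    ... | tri< l _ _ = y , inj₁ l , inj₂ refl
    ... | tri≈ _ p _ = y , inj₂ p , inj₂ refl
    ... | tri> _ _ l = x , inj₂ refl , inj₁ l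

    max : ⟨ γ ⟩ × ⟨ γ ⟩ → ⟨ γ ⟩
    max (x , y) = proj₁ (upper-bound x y)

    ≤-<-trans : ∀ {x y z} → x ≤ y → y < z → x < z
    ≤-<-trans (inj₁ p) q    = <-trans p q
    ≤-<-trans (inj₂ refl) q = q

    <-≤-trans : ∀ {x y z} → x < y → y ≤ z → x < z
    <-≤-trans p (inj₁ q)    = <-trans p q
    <-≤-trans p (inj₂ refl) = p

    ≤-trans : ∀ {x y z} → x ≤ y → y ≤ z → x ≤ z
    ≤-trans (inj₁ p) q    = inj₁ (<-≤-trans p q)
    ≤-trans (inj₂ refl) q = q

    ≰⇒> : ∀ {x y} → ¬ (x ≤ y) → y < x
    ≰⇒> {x} {y} n with compare x y
    ... | tri< l _ _ = contradiction (inj₁ l) n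
    ... | tri≈ _ p _ = contradiction (inj₂ p) n
    ... | tri> _ _ l = l

    -- Gödel's well-ordering of pairs, in which the predecessors of p lie in the
    -- square on the closed segment up to max p.
    _⊏_ : Rel (⟨ γ ⟩ × ⟨ γ ⟩) ℓ
    _⊏_ = ×-Lex _≡_ _<_ (×-Lex _≡_ _<_ _<_) on (λ p → max p , p)

    ⊏-wellFounded : WellFounded _⊏_
    ⊏-wellFounded = On.wellFounded _ (×-wellFounded wellFounded (×-wellFounded wellFounded wellFounded))

    ⊏-connected : ∀ {p q} → p ≢ q → p ⊏ q ⊎ q ⊏ p
    ⊏-connected {p} {q} p≢q with compare (max p) (max q)
    ... | tri< l _ _ = inj₁ (inj₁ l)
    ... | tri> _ _ l = inj₂ (inj₁ l)
    ... | tri≈ _ e _ with compare (proj₁ p) (proj₁ q)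
    ...   | tri< l _ _ = inj₁ (inj₂ (e , inj₁ l))
    ...   | tri> _ _ l = inj₂ (inj₂ (sym e , inj₁ l))
    ...   | tri≈ _ e₁ _ with compare (proj₂ p) (proj₂ q)
    ...     | tri< l _ _  = inj₁ (inj₂ (e , inj₂ (e₁ , l)))
    ...     | tri> _ _ l  = inj₂ (inj₂ (sym e , inj₂ (sym e₁ , l)))
    ...     | tri≈ _ e₂ _ = contradiction (cong₂ _,_ e₁ e₂) p≢q

    ⊏⇒max≤ : ∀ {p q} → p ⊏ q → max p ≤ max q
    ⊏⇒max≤ (inj₁ l)       = inj₁ l
    ⊏⇒max≤ (inj₂ (e , _)) = inj₂ e

    ⊏-segment-↣ : ∀ p → Refinement (⟨ γ ⟩ × ⟨ γ ⟩) (_⊏ p) ↣ (γ ⇓ max p × γ ⇓ max p)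
    ⊏-segment-↣ p = mk↣
      {to = λ { ((x , y) , [ l ]) →
        (x , [ ≤-trans (proj₁ (proj₂ (upper-bound x y))) (⊏⇒max≤ l) ]) ,
        (y , [ ≤-trans (proj₂ (proj₂ (upper-bound x y))) (⊏⇒max≤ l) ]) }}
      λ e → value-injective (cong₂ _,_ (cong value (,-injectiveˡ e)) (cong value (,-injectiveʳ e)))

  -- Gödel's order on pairs is compared with `γ`: were the pairs too many, `γ` would embed below
  -- some pair, hence into the square of a closed segment.
  cardinal-square : (γ : Ordinal ℓ) → IsCardinal γ →
    (∀ α → SquareBounded ⟨ γ ↓ α ⟩) →
    SquareBounded ⟨ γ ⟩
  cardinal-square γ card square ω≤γ with comparability (⊏-wellFounded γ) (⊏-connected γ) ⟨ γ ⟩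
  ... | inj₁ e       = e
  ... | inj₂ (p , e) = contradiction (e ⨾ ⊏-segment-↣ γ p) (cardinal-⋠-square γ card ω≤γ square (max γ p))

  square-resp-↔ : A ↔ B → SquareBounded A → SquareBounded B
  square-resp-↔ e square ω≤B = ×-↣ e⁻¹ e⁻¹ ⨾ square (ω≤B ⨾ e⁻¹) ⨾ ↔⇒↣ e
    where e⁻¹ = ↔⇒↣ (↔-sym e)

  -- By induction: a cardinal segment falls under `cardinal-square`, any other is equinumerous with
  -- a shorter one.
  segment-square : (γ : Ordinal ℓ) → ∀ α → SquareBounded ⟨ γ ↓ α ⟩
  segment-square {ℓ} γ = All.wfRec wellFounded ℓ _ go
    where
    open Ordinal γ
    go : ∀ α → WfRec _<_ (λ α → SquareBounded ⟨ γ ↓ α ⟩) α → SquareBounded ⟨ γ ↓ α ⟩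
    go α IH with dec (∃[ β ] (⟨ γ ↓ α ⟩ ↔ ⟨ γ ↓ α ↓ β ⟩))
    ... | yes (β , e) = square-resp-↔ (↔-sym (↔-trans e (↓-↓ γ β))) (IH (↓-< γ β))
    ... | no n = cardinal-square (γ ↓ α) (λ β e → n (β , e))
                   λ β → square-resp-↔ (↔-sym (↓-↓ γ β)) (IH (↓-< γ β))

  -- Transport of well-orders and codings.

  pullback : {A : Set ℓ} (γ : Ordinal ℓ) → A ↣ ⟨ γ ⟩ → Ordinal ℓ
  pullback {A = A} γ e = record
    { Carrier            = A
    ; _<_                = _<_ on to e
    ; isStrictTotalOrder = record
      { isStrictPartialOrder = record
        { isEquivalence = isEquivalence
        ; irrefl        = λ p → irrefl (cong (to e) p)
        ; trans         = <-trans
        ; <-resp-≈      = (λ { refl p → p }) , (λ { refl p → p })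
        }
      ; compare = cmp
      }
    ; wellFounded = On.wellFounded (to e) wellFounded
    }
    where
    open Ordinal γ using (_<_; compare; irrefl; wellFounded) renaming (trans to <-trans)
    cmp : Trichotomous _≡_ (_<_ on to e)
    cmp x y with compare (to e x) (to e y)
    ... | tri< l n g = tri< l (n ∘ cong (to e)) g
    ... | tri≈ l p g = tri≈ l (injective e p) g
    ... | tri> l n g = tri> l (n ∘ cong (to e)) g

  Σ-↣ : {P : A → Set b} → (∀ x → P x ↣ C) → (Σ[ x ∈ A ] P x) ↣ (A × C)
  Σ-↣ {A = A} {P = P} e = mk↣ {to = λ (x , p) → x , to (e x) p} λ q → inj (,-injectiveˡ q) (,-injectiveʳ q)
    where
    inj : ∀ {x y} {p : P x} {q : P y} → x ≡ y → to (e x) p ≡ to (e y) q → (x , p) ≡ (y , q)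
    inj {x} refl q = cong (x ,_) (injective (e x) q)

  retraction : A → (e : A ↣ B) → Σ[ r ∈ (B → A) ] (∀ x → r (to e x) ≡ x)
  retraction {A = A} {B = B} x₀ e = r , r-to
    where
    r : B → A
    r y with dec (∃[ x ] to e x ≡ y)
    ... | yes (x , _) = x
    ... | no _        = x₀
    r-to : ∀ x → r (to e x) ≡ x
    r-to x with dec (∃[ z ] to e z ≡ to e x)
    ... | yes (_ , p) = injective e p
    ... | no n        = contradiction (x , refl) n

  -- A sequence on an initial segment of γ is coded by its graph.
  graph-↣ : (γ : Ordinal ℓ) → BoundedSequence γ Bool ↣ (⟨ γ ⟩ × Bool → Bool)
  graph-↣ γ = mk↣ {to = λ s x → does (dec (Graph s x))} λ {s} {t} p →
    inj s t (⊆-graph {s} {t} λ x → cong (λ u → u x) p)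
            (⊆-graph {t} {s} λ x → cong (λ u → u x) (sym p))
    where
    open Ordinal γ using (_<_; compare; irrefl)
    Graph : BoundedSequence γ Bool → ⟨ γ ⟩ × Bool → Set _
    Graph (α , s) (ξ , b) = Σ[ l ∈ ξ < α ] s (ξ , [ l ]) ≡ b

    ⊆-graph : ∀ {s t} → (∀ x → does (dec (Graph s x)) ≡ does (dec (Graph t x))) →
              ∀ x → Graph s x → Graph t x
    ⊆-graph {s} {t} p x g with dec (Graph t x) | trans (sym (p x)) (dec-true (dec (Graph s x)) g)
    ... | yes h | _ = h

    inj : ∀ s t → (∀ x → Graph s x → Graph t x) → (∀ x → Graph t x → Graph s x) → s ≡ t
    inj (α , s) (β , t) p q with compare α β
    -- The longer sequence has a value at position `α`, the length of the shorter one.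
    ... | tri< l _ _ = contradiction (proj₁ (q (α , _) (l , refl))) (irrefl refl)
    ... | tri> _ _ l = contradiction (proj₁ (p (β , _) (l , refl))) (irrefl refl)
    ... | tri≈ _ refl _ = cong (α ,_) (ext λ ξ → sym (proj₂ (p (value ξ , s ξ) (↓-< γ ξ , refl))))

  -- The bounded topology

  module _ (γ : Ordinal ℓ) (A : Set a) where

    open Ordinal γ using (_≤_)

    restrict : (α : ⟨ γ ⟩) → Sequence γ A → BoundedSequence γ A
    restrict α x = α , x ∘ value

    -- Openness in neighbourhood form, with cones centred at the point itself; the next lemmas show
    -- that it agrees with generation by cones.
    Local : Pred (Sequence γ A) (a ⊔ ℓ) → Set _
    Local P = ∀ {x} → P x → ∃[ α ] (cone γ A (restrict α x) ⊆ P)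

    cone-shrink : ∀ {α β x} → α ≤ β → cone γ A (restrict β x) ⊆ cone γ A (restrict α x)
    cone-shrink α≤β p ξ = p (value ξ , [ <-≤-trans γ (↓-< γ ξ) α≤β ])

    local⇒open : ∀ {P} → Local P → GeneratedOpen (cone γ A) P
    local⇒open {P} local = resp
      ((λ { ((x , p) , q) → proj₂ (local p) q }) , λ {x} p → (x , p) , λ _ → refl)
      (union {J = ∃[ x ] P x} λ (x , p) → basic (restrict (proj₁ (local p)) x))

    open⇒local : ⟨ γ ⟩ → ∀ {P} → GeneratedOpen (cone γ A) P → Local P
    open⇒local _ (basic (α , s)) p = α , λ q ξ → trans (q ξ) (p ξ)
    open⇒local o (resp (P⊆Q , Q⊆P) oP) q =
      let α , h = open⇒local o oP (Q⊆P q) in α , P⊆Q ∘ h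
    -- The whole space suggests no length; `o` supplies one.
    open⇒local o whole _ = o , _
    open⇒local o (inter oP oQ) (p , q) =
      let α , h   = open⇒local o oP p
          β , k   = open⇒local o oQ q
          m , l , r = upper-bound γ α β
      in m , λ c → h (cone-shrink l c) , k (cone-shrink r c)
    open⇒local o (union oP) (j , p) =
      let α , h = open⇒local o (oP j) p in α , λ c → j , h c

  -- Small sets and cofinality

  module _ (Λ : Ordinal ℓ) (card : IsCardinal Λ) (ω≤Λ : ℕ ↣ ⟨ Λ ⟩) where

    open Ordinal Λ using (_<_; _≤_)

    -- If `ξ` were last, `Λ` would be the closed segment up to `ξ`, which the diagonal embeds in its
    -- own square, too small for `Λ`.
    cardinal-limit : ∀ ξ → ∃[ η ] ξ < η
    cardinal-limit ξ with dec (∃[ η ] ξ < η)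
    ... | yes e = e
    ... | no n  = contradiction (all ⨾ diagonal-↣) (cardinal-⋠-square Λ card ω≤Λ (segment-square Λ) ξ)
      where
      all : ⟨ Λ ⟩ ↣ Λ ⇓ ξ
      all = mk↣ {to = λ η → η , [ ≮⇒≥ η ]} (cong value)
        where
        ≮⇒≥ : ∀ η → η ≤ ξ
        ≮⇒≥ η with dec (η ≤ ξ)
        ... | yes p = p
        ... | no p  = contradiction (η , ≰⇒> Λ p) n

    finite-↣-segment : ∀ {n} → A ↣ Fin n → ∃[ α ] (A ↣ ⟨ Λ ↓ α ⟩)
    finite-↣-segment {A = A} e with ordinal-comparability Λ A
    ... | inj₁ f = contradiction (ω≤Λ ⨾ f ⨾ e) (ℕ⋠Fin _)
    ... | inj₂ f = f

    -- Otherwise `Λ` embeds in the product, hence in the square of the closed segment up to the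
    -- larger bound.
    ×-↣-segment : ∀ {α β} → A ↣ ⟨ Λ ↓ α ⟩ → B ↣ ⟨ Λ ↓ β ⟩ → ∃[ μ ] ((A × B) ↣ ⟨ Λ ↓ μ ⟩)
    ×-↣-segment {A = A} {B = B} {α} {β} e f with ordinal-comparability Λ (A × B) | upper-bound Λ α β
    ... | inj₂ g | _ = g
    ... | inj₁ g | m , α≤m , β≤m =
      contradiction (g ⨾ ×-↣ (e ⨾ widen α≤m) (f ⨾ widen β≤m)) (cardinal-⋠-square Λ card ω≤Λ (segment-square Λ) m)
      where
      widen : ∀ {α} → α ≤ m → ⟨ Λ ↓ α ⟩ ↣ Λ ⇓ m
      widen α≤m = mk↣ {to = λ ξ → value ξ , [ inj₁ (<-≤-trans Λ (↓-< Λ ξ) α≤m) ]}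
                      (value-injective ∘ cong value)

  module _ (Λ : Ordinal ℓ) (cofΛ : Ordinal ℓ) (cof : IsCofinality Λ cofΛ) where

    open Ordinal Λ using (_<_; _≤_)
    open Ordinal cofΛ using () renaming (_<_ to _<ᶜ_; compare to compareᶜ)

    -- By minimality of the cofinality `f` is not cofinal, and a point that no value reaches lies
    -- strictly above them all.
    segment-bounded : ∀ ρ (f : ⟨ cofΛ ↓ ρ ⟩ → ⟨ Λ ⟩) → ∃[ ξ ] (∀ ι → f ι < ξ)
    segment-bounded ρ f with ¬∀⇒∃ (λ c → proj₂ cof ρ (f , c))
    ... | ξ , n = ξ , λ ι → ≰⇒> Λ (λ l → n (ι , l))

    -- Otherwise `Λ` embeds in `cofΛ ↓ ρ`, and a retraction, with `o` as default value, maps this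
    -- short segment onto `Λ`, against `segment-bounded`.
    cof-segment-↣ : ⟨ Λ ⟩ → ∀ ρ → ∃[ β ] (⟨ cofΛ ↓ ρ ⟩ ↣ ⟨ Λ ↓ β ⟩)
    cof-segment-↣ o ρ with ordinal-comparability Λ ⟨ cofΛ ↓ ρ ⟩
    ... | inj₂ e = e
    ... | inj₁ e =
      let r , r-to = retraction o e
          ξ , r<ξ  = segment-bounded ρ r
      in contradiction (subst (_< ξ) (r-to ξ) (r<ξ (to e ξ))) (Ordinal.irrefl Λ refl)

    -- The cofinal map need not be monotone, so `κ` is chosen with `f κ` above all values at indices
    -- up to `ι`; such a `κ` cannot be one of these indices.
    cof-limit : (∀ ξ → ∃[ η ] ξ < η) → ∀ ι → ∃[ κ ] ι <ᶜ κ
    cof-limit limit ι = κ-later (compareᶜ (proj₁ late) ι)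
      where
      f : ⟨ cofΛ ⟩ → ⟨ Λ ⟩
      f = proj₁ (proj₁ cof)
      late : ∃[ κ ] (∀ (ι′ : ⟨ cofΛ ↓ ι ⟩) → f (value ι′) < f κ) × f ι < f κ
      late =
        let ξ , f<ξ        = segment-bounded ι (f ∘ value)
            m , ξ≤m , fι≤m = upper-bound Λ ξ (f ι)
            η , m<η        = limit m
            κ , η≤fκ       = proj₂ (proj₁ cof) η
            m<fκ           = <-≤-trans Λ m<η η≤fκ
        in κ , (λ ι′ → <-≤-trans Λ (f<ξ ι′) (≤-trans Λ ξ≤m (inj₁ m<fκ))) , ≤-<-trans Λ fι≤m m<fκ
      κ-later : Tri (proj₁ late <ᶜ ι) (proj₁ late ≡ ι) (ι <ᶜ proj₁ late) → ∃[ κ ] ι <ᶜ κ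
      κ-later (tri> _ _ l) = _ , l
      κ-later (tri≈ _ p _) = contradiction (proj₂ (proj₂ late)) (Ordinal.irrefl Λ (cong f (sym p)))
      κ-later (tri< l _ _) = contradiction (proj₁ (proj₂ late) (_ , [ l ])) (Ordinal.irrefl Λ refl)

  -- The weak power

  module WeakPower (Λ : Ordinal ℓ) (card : IsCardinal Λ) (ω≤Λ : ℕ ↣ ⟨ Λ ⟩)
                   (Λ′ : Ordinal ℓ) (pow : IsWeakPower Bool Λ Λ′) where

    open IsWeakPower pow using (isCardinal; upperBound)

    -- The weak power speaks of cardinal exponents only, so the segment is first replaced by its
    -- cardinality.
    2^-↣ : ∀ {α} → A ↣ ⟨ Λ ↓ α ⟩ → (A → Bool) ↣ ⟨ Λ′ ⟩
    2^-↣ {α = α} e =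
      let ρ , cardρ , f = cardinal-segment Λ α
      in domain-↣ false (e ⨾ ↔⇒↣ f) ⨾ upperBound ρ cardρ

    -- If instead λ′ embeds in a segment `α`, so does its subset 2^α, against Cantor.
    Λ↣Λ′ : ⟨ Λ ⟩ ↣ ⟨ Λ′ ⟩
    Λ↣Λ′ with ordinal-comparability Λ ⟨ Λ′ ⟩
    ... | inj₁ e       = e
    ... | inj₂ (α , e) = contradiction (2^-↣ {α = α} ↣-refl ⨾ e) cantor

    Λ×Λ′-↣ : (⟨ Λ ⟩ × ⟨ Λ′ ⟩) ↣ ⟨ Λ′ ⟩
    Λ×Λ′-↣ = ×-↣ Λ↣Λ′ ↣-refl ⨾ cardinal-square Λ′ isCardinal (segment-square Λ′) (ω≤Λ ⨾ Λ↣Λ′)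

    sequences-↣ : BoundedSequence Λ Bool ↣ ⟨ Λ′ ⟩
    sequences-↣ = Σ-↣ (λ α → 2^-↣ {α = α} ↣-refl) ⨾ Λ×Λ′-↣

    -- Well-ordered through `sequences-↣`, the bounded sequences have a cardinality `σ`. It bounds
    -- every 2^ρ, since the sequences of length `ρ` are among them, and λ′ is least.
    ↣-sequences : ⟨ Λ′ ⟩ ↣ BoundedSequence Λ Bool
    ↣-sequences =
      let σ , cardσ , e = cardinality (pullback Λ′ sequences-↣)
      in IsWeakPower.least pow σ cardσ (λ ρ _ → mk↣ {to = ρ ,_} (λ { refl → refl }) ⨾ ↔⇒↣ e)
           ⨾ ↔⇒↣ (↔-sym e)

    module _ (cofΛ : Ordinal ℓ) (cof : IsCofinality Λ cofΛ) where

      -- Fewer than cof(λ) bounded sequences have a common bound ξ < λ on their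
      -- lengths, so together they amount to ξ and a subset of a set of size < λ.
      bounded-family : ∀ ρ → (⟨ cofΛ ↓ ρ ⟩ → BoundedSequence Λ Bool) ↣
                             (Σ[ ξ ∈ ⟨ Λ ⟩ ] (⟨ cofΛ ↓ ρ ⟩ → BoundedSequence (Λ ↓ ξ) Bool))
      -- `decode` undoes `encode` definitionally.
      bounded-family ρ = mk↣ {to = encode} λ p → cong decode p
        where
        encode : (⟨ cofΛ ↓ ρ ⟩ → BoundedSequence Λ Bool) → _
        encode g =
          let ξ , <ξ = segment-bounded Λ cofΛ cof ρ (proj₁ ∘ g)
          in ξ , λ ι → (proj₁ (g ι) , [ <ξ ι ]) , proj₂ (g ι) ∘ Inverse.to (↓-↓ Λ (proj₁ (g ι) , [ <ξ ι ]))
        decode : (Σ[ ξ ∈ ⟨ Λ ⟩ ] (⟨ cofΛ ↓ ρ ⟩ → BoundedSequence (Λ ↓ ξ) Bool)) →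
                 ⟨ cofΛ ↓ ρ ⟩ → BoundedSequence Λ Bool
        decode (ξ , h) ι = value (proj₁ (h ι)) , proj₂ (h ι) ∘ Inverse.from (↓-↓ Λ (proj₁ (h ι)))

      -- Replacing each sequence by its graph turns a family into one subset of ρ × (ξ × 2), a set
      -- that embeds in a segment of `Λ`.
      families-↣ : ∀ ρ ξ → (⟨ cofΛ ↓ ρ ⟩ → BoundedSequence (Λ ↓ ξ) Bool) ↣ ⟨ Λ′ ⟩
      families-↣ ρ ξ = codomain-↣ (graph-↣ (Λ ↓ ξ)) ⨾ uncurry-↣ ⨾ 2^-↣ (proj₂ small)
        where
        small : ∃[ μ ] ((⟨ cofΛ ↓ ρ ⟩ × (⟨ Λ ↓ ξ ⟩ × Bool)) ↣ ⟨ Λ ↓ μ ⟩)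
        small = ×-↣-segment Λ card ω≤Λ (proj₂ (cof-segment-↣ Λ cofΛ cof (to ω≤Λ 0) ρ))
                  (proj₂ (×-↣-segment Λ card ω≤Λ {α = ξ} ↣-refl
                    (proj₂ (finite-↣-segment Λ card ω≤Λ (↔⇒↣ (↔-sym 2↔Bool))))))

      weak-power : IsWeakPower ⟨ Λ′ ⟩ cofΛ Λ′
      weak-power = record
        { isCardinal = isCardinal
        ; upperBound = λ ρ _ → codomain-↣ ↣-sequences ⨾ bounded-family ρ ⨾ Σ-↣ (families-↣ ρ) ⨾ Λ×Λ′-↣
        ; least      = λ σ _ bound →
            -- Here `ρ` is the ordinal 1, the first with a predecessor, hence a cardinal: a
            -- bijection with a smaller segment would give that one a predecessor. Constant
            -- functions embed λ′ into its power.
            let ρ , (ι , ι<ρ) , minimal = first-nonempty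
            in mk↣ {to = λ x _ → x} (cong (λ s → s (ι , [ ι<ρ ])))
                 ⨾ bound ρ (λ α e → minimal (value α) (↓-< cofΛ α)
                              (let β = Inverse.to e (ι , [ ι<ρ ]) in value (value β) , ↓-< (cofΛ ↓ ρ) {α} β))
        }
        where
        open Ordinal cofΛ using () renaming (_<_ to _<ᶜ_; wellFounded to wellFoundedᶜ)
        limitᶜ : ∀ ι → ∃[ κ ] ι <ᶜ κ
        limitᶜ = cof-limit Λ cofΛ cof (cardinal-limit Λ card ω≤Λ)
        first-nonempty : ∃[ ρ ] ((∃[ ι ] ι <ᶜ ρ) × (∀ κ → κ <ᶜ ρ → ¬ (∃[ ι ] ι <ᶜ κ)))
        first-nonempty =
          let ι , _ = proj₂ (proj₁ cof) (to ω≤Λ 0)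
              κ , l = limitᶜ ι
          in least wellFoundedᶜ (λ ρ → ∃[ ι ] ι <ᶜ ρ) (κ , ι , l)

  -- The embedding

  module Embedding (Λ : Ordinal ℓ) (limit : ∀ ξ → ∃[ η ] Ordinal._<_ Λ ξ η) (o : ⟨ Λ ⟩)
                   (cofΛ : Ordinal ℓ) (cof : IsCofinality Λ cofΛ)
                   (Y : Set ℓ) (code : BoundedSequence Λ Bool ↣ Y) where

    open Ordinal Λ using (_<_)
    open Ordinal cofΛ using () renaming (_<_ to _<ᶜ_)

    limitᶜ : ∀ ι → ∃[ κ ] ι <ᶜ κ
    limitᶜ = cof-limit Λ cofΛ cof limit

    -- One step beyond the cofinal value, so that `ξ ≤ f ι` puts `ξ` strictly inside the
    -- restriction.
    length : ⟨ cofΛ ⟩ → ⟨ Λ ⟩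
    length ι = proj₁ (limit (proj₁ (proj₁ cof) ι))

    index : ⟨ Λ ⟩ → ⟨ cofΛ ⟩
    index ξ = proj₁ (proj₂ (proj₁ cof) ξ)

    <-length-index : ∀ ξ → ξ < length (index ξ)
    <-length-index ξ = ≤-<-trans Λ (proj₂ (proj₂ (proj₁ cof) ξ)) (proj₂ (limit _))

    Φ : Sequence Λ Bool → Sequence cofΛ Y
    Φ x ι = to code (restrict Λ Bool (length ι) x)

    Φ-determines : ∀ {x y ι} → Φ x ι ≡ Φ y ι → ∀ (ξ : ⟨ Λ ↓ length ι ⟩) → x (value ξ) ≡ y (value ξ)
    Φ-determines {x} {y} p = agree refl (injective code p)
      where
      -- With the lengths as variables the equation of pairs can be matched on; at `q = refl` the
      -- `subst` disappears.
      agree : ∀ {α β s t} (q : α ≡ β) → _≡_ {A = BoundedSequence Λ Bool} (α , s) (β , t) →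
              ∀ ξ → s ξ ≡ t (subst (λ α → ⟨ Λ ↓ α ⟩) q ξ)
      agree refl refl ξ = refl

    Φ-cong : ∀ {x y ι} → (∀ (ξ : ⟨ Λ ↓ length ι ⟩) → x (value ξ) ≡ y (value ξ)) → Φ x ι ≡ Φ y ι
    Φ-cong p = cong (λ s → to code (_ , s)) (ext p)

    Image : Pred (Sequence cofΛ Y) ℓ
    Image y = ∃[ x ] Φ x ≡ y

    Φ-injective : ∀ {x y} → Φ x ≡ Φ y → x ≡ y
    Φ-injective p = ext λ ξ →
      Φ-determines (cong (λ s → s (index ξ)) p) (ξ , [ <-length-index ξ ])

    -- Two approximations whose images both match `y` at `ι` agree below `length ι`. Hence `x` may
    -- take its value at each `ξ` from any approximation that is good at `index ξ`.
    limit-of-images : ∀ {y} → (∀ α → ∃[ x ] cone cofΛ Y (restrict cofΛ Y α y) (Φ x)) → Image y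
    limit-of-images {y} approx = x , ext λ ι → trans (Φ-cong (x-agrees ι)) (approximation-at ι (proj₂ (limitᶜ ι)))
      where
      approximation : ⟨ cofΛ ⟩ → Sequence Λ Bool
      approximation α = proj₁ (approx α)
      approximation-at : ∀ {α} ι → ι <ᶜ α → Φ (approximation α) ι ≡ y ι
      approximation-at {α} ι l = proj₂ (approx α) (ι , [ l ])
      next : ⟨ cofΛ ⟩ → ⟨ cofΛ ⟩
      next ι = proj₁ (limitᶜ ι)
      next-agrees : ∀ {α} ι → ι <ᶜ α → ∀ (ξ : ⟨ Λ ↓ length ι ⟩) →
                    approximation (next ι) (value ξ) ≡ approximation α (value ξ)
      next-agrees ι l = Φ-determines
        (trans (approximation-at ι (proj₂ (limitᶜ ι))) (sym (approximation-at ι l)))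
      x : Sequence Λ Bool
      x ξ = approximation (next (index ξ)) ξ
      x-agrees : ∀ ι (ξ : ⟨ Λ ↓ length ι ⟩) → x (value ξ) ≡ approximation (next ι) (value ξ)
      x-agrees ι ξ =
        -- Both sides are compared with one approximation that is good at `ι` and at
        -- `index (value ξ)`.
        let m , ι≤m , κ≤m = upper-bound cofΛ ι (index (value ξ))
            α , m<α       = limitᶜ m
        in trans (next-agrees (index (value ξ)) (≤-<-trans cofΛ κ≤m m<α) (value ξ , [ <-length-index (value ξ) ]))
                 (sym (next-agrees ι (≤-<-trans cofΛ ι≤m m<α) ξ))

    -- The contrapositive of `limit-of-images`: a point outside the image has a cone that no image
    -- meets.
    Image-closed : Topology.Closed (bounded cofΛ Y) Image
    Image-closed = local⇒open cofΛ Y local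
      where
      local : ∀ {y} → ¬ Image y → ∃[ α ] (∀ {z} → cone cofΛ Y (restrict cofΛ Y α y) z → ¬ Image z)
      local n with ¬∀⇒∃ (n ∘ limit-of-images)
      ... | α , disjoint = α , λ { c (x , refl) → disjoint (x , c) }

    homeomorphism : Homeomorphic (bounded Λ Bool) (subspace (bounded cofΛ Y) Image)
    homeomorphism = mk↔ₛ′ to′ from′ to-from from-to , to-continuous , from-continuous
      where
      to′ : Sequence Λ Bool → Refinement (Sequence cofΛ Y) Image
      to′ x = Φ x , [ x , refl ]
      preimage : ∀ y → ∃[ x ] Φ x ≡ value {P = Image} y
      -- Membership in the image is irrelevant, so a preimage is found anew; `Φ-injective` makes it
      -- the only one.
      preimage (y , [ p ]) = recompute em p
      from′ : Refinement (Sequence cofΛ Y) Image → Sequence Λ Bool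
      from′ = proj₁ ∘ preimage
      to-from : ∀ y → to′ (from′ y) ≡ y
      to-from y = value-injective (proj₂ (preimage y))
      from-to : ∀ x → from′ (to′ x) ≡ x
      from-to x = Φ-injective (proj₂ (preimage (to′ x)))

      to-continuous : Continuous (bounded Λ Bool) (subspace (bounded cofΛ Y) Image) to′
      to-continuous P (V , oV , P⊆V , V⊆P) = local⇒open Λ Bool λ p →
        let α , h   = open⇒local cofΛ Y (index o) oV (P⊆V p)
            -- The coordinates below `α` see restrictions of many lengths; `ξ` exceeds all of these.
            ξ , <ξ  = segment-bounded Λ cofΛ cof α (length ∘ value)
        in ξ , λ c → V⊆P (h λ ι → Φ-cong (cone-shrink Λ Bool (inj₁ (<ξ ι)) c))

      from-continuous : Continuous (subspace (bounded cofΛ Y) Image) (bounded Λ Bool) from′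
      from-continuous V oV = W , local⇒open cofΛ Y W-local ,
        (λ {y} → V⊆W y) , (λ {y} (ι , h) → h (cong (λ s → s ι) (proj₂ (preimage y))))
        where
        -- The open set to pull back: sequences with a single coordinate that already forces every
        -- matching `x` into `V`.
        W : Pred (Sequence cofΛ Y) ℓ
        W y = ∃[ ι ] (∀ {x} → Φ x ι ≡ y ι → V x)
        W-local : Local cofΛ Y W
        -- A cone of length `α` fixes only coordinates below `α`, hence a length beyond `ι`.
        W-local (ι , h) = let α , l = limitᶜ ι in α , λ c → ι , λ p → h (trans p (c (ι , [ l ])))
        V⊆W : ∀ y → V (from′ y) → W (value y)
        V⊆W y v =
          let α , h = open⇒local Λ Bool o oV v
          in index α , λ p → h (cone-shrink Λ Bool (inj₁ (<-length-index α))
               (Φ-determines (trans p (cong (λ s → s (index α)) (sym (proj₂ (preimage y)))))))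

proposition2p8 : (∀ {a} → ExcludedMiddle a) →
    (∀ {a b} → Extensionality a b) →
    ∀ {ℓ} (Λ : Ordinal ℓ) → IsCardinal Λ → Infinite ⟨ Λ ⟩ →
    ∀ (Λ′ : Ordinal ℓ) → IsWeakPower Bool Λ Λ′ →
    ∀ (cofΛ : Ordinal ℓ) → IsCofinality Λ cofΛ →
    IsWeakPower ⟨ Λ′ ⟩ cofΛ Λ′ ×
    HomeomorphicToClosedSubspace (bounded Λ Bool) (bounded cofΛ ⟨ Λ′ ⟩)
proposition2p8 em ext Λ card infinite Λ′ pow cofΛ cof =
  weak-power cofΛ cof , Image , Image-closed , homeomorphism
  where
  ω≤Λ : ℕ ↣ ⟨ Λ ⟩
  ω≤Λ = Infinite⇒ℕ↣ em ext infinite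
  open WeakPower em ext Λ card ω≤Λ Λ′ pow
  open Embedding em ext Λ (cardinal-limit em ext Λ card ω≤Λ) (to ω≤Λ 0) cofΛ cof ⟨ Λ′ ⟩ sequences-↣
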